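{- For all integers $m<0$ and $n\geq 1$, \[ N(\leq m+1,n)-M(\leq m,n)=q(-m-1,n)-p(m+2,n). \]
   Context: For a partition $\lambda$, $\operatorname{rank}(\lambda)$ is its largest part minus its number of parts. $\operatorname{crank}(\lambda)$ is the largest part of $\lambda$ if $\lambda$ contains no part equal to $1$; otherwise it is the number of parts larger than the number of ones minus the number of ones. For $n\geq1$, $N(m,n)$ is the number of partitions of $n$ with rank $m$. For $n>1$, $M(m,n)$ is the number of partitions of $n$ with crank $m$. For $n=1$ one sets $M(0,1)=-1$, $M(\pm1,1)=1$ and $M(m,1)=0$ otherwise. The cumulative functions are $N(\leq m,n)=\sum_{r\leq m}N(r,n)$ and $M(\leq m,n)=\sum_{r\leq m}M(r,n)$. Define $p(m,n)=\sum_{r\geq m}N(r,n)$, the number of partitions of $n$ with rank at least $m$. For a partition $\lambda=(\lambda_1\geq\cdots\geq\lambda_\ell)$, its rank-set is the infinite sequence $[-\lambda_1,1-\lambda_2,\ldots,j-\lambda_{j+1},\ldots,\ell-1-\lambda_\ell,\ell,\ell+1,\ldots]$. Then $q(m,n)$ is the number of partitions of $n$ whose rank-set contains $m$. -}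

module Defs where

open import Data.Integer as ℤ using (ℤ; +_; -[1+_]; ∣_∣; 0ℤ; 1ℤ; -1ℤ)
import Data.Integer.Properties as ℤ
open import Data.List using (List; []; _∷_; length; map; filter; foldr; upTo; concatMap)
open import Data.List.Membership.Propositional using (_∈_; find; lose)
open import Data.List.Membership.Propositional.Properties using (∈-concatMap⁺; ∈-concatMap⁻; ∈-map⁺; ∈-map⁻; ∈-upTo⁺; ∈-upTo⁻)
open import Data.List.Properties using (length-filter; filter-none; ∷-injectiveˡ; ∷-injectiveʳ)
open import Data.List.Relation.Unary.All as All using (All; []; _∷_)
import Data.List.Relation.Unary.All.Properties as All
open import Data.List.Relation.Unary.AllPairs as AllPairs using (AllPairs; []; _∷_)
import Data.List.Relation.Unary.AllPairs.Properties as AllPairs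
open import Data.List.Relation.Unary.Any using (here)
open import Data.List.Relation.Unary.Unique.Propositional using (Unique)
import Data.List.Relation.Unary.Unique.Propositional.Properties as Unique
open import Data.Nat using (ℕ; zero; suc; _+_; _∸_; _⊔_; _⊓_; _≤_; _<_; _≥_; z≤n; s≤s; s≤s⁻¹; _≟_; _<?_)
open import Data.Nat.ListAction using (sum)
open import Data.Nat.Properties
open import Data.Product using (∃; _×_; _,_; proj₁; proj₂)
open import Data.Sum using (_⊎_; inj₁; inj₂)
open import Function using (_∘_; _⇔_; mk⇔)
open import Relation.Binary.PropositionalEquality using (_≡_; refl; sym; trans; cong; subst)
open import Relation.Nullary using (Dec; yes; no; ¬_)
open import Relation.Nullary.Decidable using (map′; _⊎-dec_)
open import Relation.Unary using (Pred; Decidable)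
open import Level using (0ℓ)

record IsPartition (n : ℕ) (λs : List ℕ) : Set where
  constructor isPartition
  field
    decreasing : AllPairs _≥_ λs
    positive   : All (0 <_) λs
    total      : sum λs ≡ n

open IsPartition public

-- The partitions of n with at most ℓ parts, all of them at most k; the
-- first part is 1 + i.
partitionsWithin : (ℓ k n : ℕ) → List (List ℕ)
partitionsWithin ℓ       k zero    = [] ∷ []
partitionsWithin zero    k (suc n) = []
partitionsWithin (suc ℓ) k (suc n) =
  concatMap (λ i → map (suc i ∷_) (partitionsWithin ℓ (suc i) (n ∸ i)))
            (upTo (k ⊓ suc n))

partitions : ℕ → List (List ℕ)
partitions n = partitionsWithin n n n

-- `partitions n` lists every partition of n (∈-partitions) exactly once
-- (partitions-unique), so filtering it counts partitions.

private
  within-sound : ∀ ℓ k n {λs} → λs ∈ partitionsWithin ℓ k n →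
                 IsPartition n λs × All (_≤ k) λs
  within-sound ℓ k zero (here refl) = isPartition [] [] refl , []
  within-sound (suc ℓ) k (suc n) λs∈
    with i , i∈ , λs∈ᵢ ← find (∈-concatMap⁻ _ {xs = upTo (k ⊓ suc n)} λs∈)
    with μs , μs∈ , refl ← ∈-map⁻ (suc i ∷_) λs∈ᵢ
    with isPartition d p t , μs≤ ← within-sound ℓ (suc i) (n ∸ i) μs∈
    = isPartition (μs≤ ∷ d) (s≤s z≤n ∷ p)
        (cong suc (trans (cong (λ s → i + s) t) (m+[n∸m]≡n i≤n)))
    , i<k ∷ All.map (λ x≤ → ≤-trans x≤ i<k) μs≤
    where
    i<k : i < k
    i<k = ≤-trans (∈-upTo⁻ i∈) (m⊓n≤m k (suc n))
    i≤n : i ≤ n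
    i≤n = s≤s⁻¹ (≤-trans (∈-upTo⁻ i∈) (m⊓n≤n k (suc n)))

  within-complete : ∀ ℓ k n {λs} → IsPartition n λs → All (_≤ k) λs →
                    length λs ≤ ℓ → λs ∈ partitionsWithin ℓ k n
  within-complete ℓ k zero {[]} _ _ _ = here refl
  within-complete ℓ k zero {zero ∷ _} (isPartition _ (() ∷ _) _) _ _
  within-complete ℓ k (suc n) {zero ∷ _} (isPartition _ (() ∷ _) _) _ _
  within-complete zero k (suc n) {[]} (isPartition _ _ ()) _ _
  within-complete (suc ℓ) k (suc n) {[]} (isPartition _ _ ()) _ _
  within-complete (suc ℓ) k (suc n) {suc i ∷ μs} (isPartition (μs≤ ∷ d) (_ ∷ p) t) (i<k ∷ _) (s≤s len) =
    ∈-concatMap⁺ _ (lose (∈-upTo⁺ (⊓-glb i<k (s≤s i≤n)))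
      (∈-map⁺ (suc i ∷_)
        (within-complete ℓ (suc i) (n ∸ i) (isPartition d p sum≡) μs≤ len)))
    where
    i+sum≡n : i + sum μs ≡ n
    i+sum≡n = suc-injective t
    i≤n : i ≤ n
    i≤n = subst (i ≤_) i+sum≡n (m≤m+n i (sum μs))
    sum≡ : sum μs ≡ n ∸ i
    sum≡ = trans (sym (m+n∸m≡n i (sum μs))) (cong (_∸ i) i+sum≡n)

  within-unique : ∀ ℓ k n → Unique (partitionsWithin ℓ k n)
  within-unique ℓ       k zero    = [] ∷ []
  within-unique zero    k (suc n) = []
  within-unique (suc ℓ) k (suc n) = Unique.concat⁺
    (All.map⁺ (All.universal
      (λ i → Unique.map⁺ ∷-injectiveʳ (within-unique ℓ (suc i) (n ∸ i))) _))
    (AllPairs.map⁺ (AllPairs.map disjoint (Unique.upTo⁺ (k ⊓ suc n))))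
    where
    disjoint : ∀ {i j} → ¬ i ≡ j → ∀ {λs} →
      ¬ (λs ∈ map (suc i ∷_) (partitionsWithin ℓ (suc i) (n ∸ i)) ×
         λs ∈ map (suc j ∷_) (partitionsWithin ℓ (suc j) (n ∸ j)))
    disjoint i≢j (a , b)
      with _ , _ , refl ← ∈-map⁻ _ a
      with _ , _ , eq ← ∈-map⁻ _ b = i≢j (suc-injective (∷-injectiveˡ eq))

  all≤sum : ∀ λs → All (_≤ sum λs) λs
  all≤sum []       = []
  all≤sum (x ∷ λs) = m≤m+n x _ ∷ All.map (λ y≤ → ≤-trans y≤ (m≤n+m _ x)) (all≤sum λs)

  length≤sum : ∀ {λs} → All (0 <_) λs → length λs ≤ sum λs
  length≤sum []       = z≤n
  length≤sum (p ∷ ps) = +-mono-≤ p (length≤sum ps)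

∈-partitions : ∀ n λs → λs ∈ partitions n ⇔ IsPartition n λs
∈-partitions n λs = mk⇔ (proj₁ ∘ within-sound n n n) complete
  where
  complete : IsPartition n λs → λs ∈ partitions n
  complete π@(isPartition _ p refl) = within-complete n n n π (all≤sum λs) (length≤sum p)

partitions-unique : ∀ n → Unique (partitions n)
partitions-unique n = within-unique n n n

count : {P : Pred (List ℕ) 0ℓ} → Decidable P → ℕ → ℕ
count P? n = length (filter P? (partitions n))

-- The value 0 at the empty list is never used for a partition of n ≥ 1.
largest : List ℕ → ℕ
largest = foldr _⊔_ 0

rank : List ℕ → ℤ
rank λs = + largest λs ℤ.- + length λs

ones : List ℕ → ℕ
ones λs = length (filter (_≟ 1) λs)

partsAbove : ℕ → List ℕ → ℕ
partsAbove w λs = length (filter (w <?_) λs)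

crank : List ℕ → ℤ
crank λs with ones λs
... | zero  = + largest λs
... | suc w = + partsAbove (suc w) λs ℤ.- + suc w

N : ℤ → ℕ → ℕ
N m n = count (λ λs → rank λs ℤ.≟ m) n

M₁ : ℤ → ℤ
M₁ (+ 0)    = -1ℤ
M₁ (+ 1)    = 1ℤ
M₁ -[1+ 0 ] = 1ℤ
M₁ _        = 0ℤ

-- n = 0 is not covered by the definition of M and is never used.
M : ℤ → ℕ → ℤ
M m 1 = M₁ m
M m n = + count (λ λs → crank λs ℤ.≟ m) n

FinitelySupported : (ℤ → ℤ) → Set
FinitelySupported f = ∃ λ b → ∀ r → b < ∣ r ∣ → f r ≡ 0ℤ

-- [-b, …, b]
window : ℕ → List ℤ
window b = map (λ i → + i ℤ.- + b) (upTo (suc (b + b)))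

sumℤ : List ℤ → ℤ
sumℤ = foldr ℤ._+_ 0ℤ

-- Σ_{r ≤ m} f r and Σ_{r ≥ m} f r: all omitted terms vanish.
Σ≤ Σ≥ : (f : ℤ → ℤ) → FinitelySupported f → ℤ → ℤ
Σ≤ f (b , _) m = sumℤ (map f (filter (ℤ._≤? m) (window b)))
Σ≥ f (b , _) m = sumℤ (map f (filter (m ℤ.≤?_) (window b)))

private
  largest≤ : ∀ {n λs} → All (_≤ n) λs → largest λs ≤ n
  largest≤ []       = z≤n
  largest≤ (p ∷ ps) = ⊔-lub p (largest≤ ps)

  ∣-∣≤ : ∀ {a b n} → a ≤ n → b ≤ n → ∣ + a ℤ.- + b ∣ ≤ n
  ∣-∣≤ {a} {b} a≤n b≤n = ≤-trans
    (subst (λ z → ∣ z ∣ ≤ a ⊔ b) (sym (ℤ.m-n≡m⊖n a b)) (ℤ.∣m⊝n∣≤m⊔n a b))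
    (⊔-lub a≤n b≤n)

  largest≤n : ∀ {n λs} → IsPartition n λs → largest λs ≤ n
  largest≤n {λs = λs} (isPartition _ _ refl) = largest≤ (all≤sum λs)

  length≤n : ∀ {n λs} → IsPartition n λs → length λs ≤ n
  length≤n (isPartition _ p refl) = length≤sum p

  ∣rank∣≤ : ∀ {n λs} → IsPartition n λs → ∣ rank λs ∣ ≤ n
  ∣rank∣≤ π = ∣-∣≤ (largest≤n π) (length≤n π)

  ∣crank∣≤ : ∀ {n λs} → IsPartition n λs → ∣ crank λs ∣ ≤ n
  ∣crank∣≤ {λs = λs} π with ones λs | length-filter (_≟ 1) λs
  ... | zero  | _  = largest≤n π
  ... | suc w | w≤ = ∣-∣≤ {a = partsAbove (suc w) λs} (≤-trans (length-filter (suc w <?_) λs) (length≤n π))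
                          (≤-trans w≤ (length≤n π))

  count-vanishes : (s : List ℕ → ℤ) → ∀ n →
    (∀ {λs} → IsPartition n λs → ∣ s λs ∣ ≤ n) →
    ∀ r → n < ∣ r ∣ → + count (λ λs → s λs ℤ.≟ r) n ≡ 0ℤ
  count-vanishes s n bound r n<r = cong (+_ ∘ length)
    (filter-none (λ λs → s λs ℤ.≟ r) (All.tabulate λ λs∈ eq →
      <⇒≱ n<r (subst (λ z → ∣ z ∣ ≤ n) eq
        (bound (proj₁ (within-sound n n n λs∈))))))

N-support : ∀ n → FinitelySupported (λ r → + N r n)
N-support n = n , count-vanishes rank n ∣rank∣≤

M-support : ∀ n → FinitelySupported (λ r → M r n)
M-support 0 = 0 , count-vanishes crank 0 ∣crank∣≤
M-support 1 = 1 , vanishes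
  where
  vanishes : ∀ r → 1 < ∣ r ∣ → M₁ r ≡ 0ℤ
  vanishes (+ suc (suc _)) _ = refl
  vanishes -[1+ suc _ ]    _ = refl
  vanishes (+ 1)           (s≤s ())
  vanishes -[1+ 0 ]        (s≤s ())
M-support n@(suc (suc _)) = n , count-vanishes crank n ∣crank∣≤

N≤ M≤ p : ℤ → ℕ → ℤ
N≤ m n = Σ≤ (λ r → + N r n) (N-support n) m
M≤ m n = Σ≤ (λ r → M r n) (M-support n) m
p  m n = Σ≥ (λ r → + N r n) (N-support n) m

-- part λs j is λ_{j+1}, taken to be 0 beyond the last part.
part : List ℕ → ℕ → ℕ
part []       _       = 0
part (x ∷ _)  zero    = x
part (_ ∷ λs) (suc j) = part λs j

rankSet : List ℕ → ℕ → ℤ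
rankSet λs j = + j ℤ.- + part λs j

_∈rankSet_ : ℤ → List ℕ → Set
m ∈rankSet λs = ∃ λ j → rankSet λs j ≡ m

private
  part-beyond : ∀ λs {j} → length λs ≤ j → part λs j ≡ 0
  part-beyond []       _         = refl
  part-beyond (_ ∷ λs) (s≤s len) = part-beyond λs len

  rankSet-beyond : ∀ λs {j} → length λs ≤ j → rankSet λs j ≡ + j
  rankSet-beyond λs {j} len rewrite part-beyond λs len = cong +_ (+-identityʳ j)

_∈rankSet?_ : ∀ m λs → Dec (m ∈rankSet λs)
m ∈rankSet? λs = map′ to from
  (anyUpTo? (λ j → rankSet λs j ℤ.≟ m) (length λs) ⊎-dec (rankSet λs ∣ m ∣ ℤ.≟ m))
  where
  Bounded : Set
  Bounded = (∃ λ j → j < length λs × rankSet λs j ≡ m) ⊎ (rankSet λs ∣ m ∣ ≡ m)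
  to : Bounded → m ∈rankSet λs
  to (inj₁ (j , _ , eq)) = j , eq
  to (inj₂ eq)           = ∣ m ∣ , eq
  from : m ∈rankSet λs → Bounded
  from (j , eq) with j <? length λs
  ... | yes j<ℓ = inj₁ (j , j<ℓ , eq)
  ... | no  j≮ℓ = inj₂ (subst (λ i → rankSet λs i ≡ m) (cong ∣_∣ (trans (sym (rankSet-beyond λs (≮⇒≥ j≮ℓ))) eq)) eq)

q : ℤ → ℕ → ℕ
q m n = count (m ∈rankSet?_) n

{-# OPTIONS --safe #-}
-- Both differences compare with the number of all partitions of n, so with
-- m = -k-1 the claim is that crank ≤ m is equidistributed with k ∉ rank-set.
--
-- First, crank ≤ m is equidistributed with m ∈ rank-set.  A partition μ with
-- m in its rank-set has a part d = a + k + 1 preceded by exactly a parts (all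
-- at least d); trade this part for d ones.  The result has ω ≥ d ones and at
-- most a = d - k - 1 ≤ ω - k - 1 parts above ω, so its crank is at most m.
-- Conversely, a partition of crank ≤ m has a longest prefix whose i-th part
-- (i = 1, 2, …) exceeds i + k; if a is its length and d = a + k + 1, the crank
-- condition forces at least d ones, and they can be traded back for a part d.
--
-- Second, conjugation exchanges m ∈ rank-set and k ∉ rank-set.
module Submission where

open import Defs
open import Data.Nat using (ℕ; _≥_)
open import Data.Integer using (ℤ; +_; _+_; _-_; -_; _<_)
open import Relation.Binary.PropositionalEquality using (_≡_)

open import Data.Empty using (⊥; ⊥-elim)
import Data.Integer as ℤ
import Data.Integer.Properties as ℤ
open import Algebra.Properties.AbelianGroup ℤ.+-0-abelianGroup using (∙-cancelʳ)
open import Data.Integer.Tactic.RingSolver using (solve-∀)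
open import Data.List using (List; []; _∷_; _++_; length; map; filter; replicate)
open import Data.List.Membership.Propositional using (_∈_)
open import Data.List.Membership.Propositional.Properties using (∈-∃++; ∈-filter⁺; ∈-filter⁻; ∈-length; ∈-map⁺; ∈-upTo⁺)
open import Data.List.Membership.DecPropositional ℤ._≟_ using (_∈?_)
open import Data.List.Properties using (length-++; ++-cancelʳ; filter-++; filter-all; filter-none; filter-reject; length-filter; length-replicate; ∷-injective)
open import Data.List.Relation.Unary.All as All using (All; []; _∷_)
import Data.List.Relation.Unary.All.Properties as All
open import Data.List.Relation.Unary.AllPairs using (AllPairs; []; _∷_)
import Data.List.Relation.Unary.AllPairs.Properties as AllPairs
open import Data.List.Relation.Unary.Any using (here; there)
import Data.List.Relation.Unary.Any.Properties as Any
open import Data.List.Relation.Unary.Unique.Propositional using (Unique)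
import Data.List.Relation.Unary.Unique.Propositional.Properties as Unique
import Data.Nat as ℕ
open import Data.Nat using (zero; suc; z≤n; s≤s; s≤s⁻¹; _≤_; _≤?_; _≟_)
open import Data.Nat.ListAction using (sum)
open import Data.Nat.ListAction.Properties using (sum-++)
import Data.Nat.Properties as ℕ
import Data.Nat.Tactic.RingSolver as ℕ-Solver
open import Data.Product using (∃; ∃₂; _×_; _,_; proj₂)
open import Data.Sum using (_⊎_; inj₁; inj₂; [_,_]′)
open import Function using (_∘_; _⇔_; mk⇔; Equivalence)
open import Level using (0ℓ)
open import Relation.Binary.PropositionalEquality using (refl; sym; trans; cong; cong₂; subst; subst₂)
open import Relation.Nullary using (¬_; yes; no; ¬?)
open import Relation.Unary using (Pred; Decidable)

open Equivalence using (to; from)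

-- Counting

module _ {A B : Set} (R : A → B → Set) (injective : ∀ {x x′ y} → R x y → R x′ y → x ≡ x′) where

  -- Each element of `xs` removes its partner from `ys`. Injectivity of `R` keeps that partner from
  -- being wanted again, so the induction goes on with the rest.
  length-≤ : ∀ {xs : List A} {ys : List B} → Unique xs →
             (∀ {x} → x ∈ xs → ∃ λ y → y ∈ ys × R x y) → length xs ≤ length ys
  length-≤ {[]} _ _ = z≤n
  length-≤ {x ∷ xs} (x∉xs ∷ xs!) total
    with y , y∈ , Rxy ← total (here refl)
    with as , bs , refl ← ∈-∃++ y∈
    = subst (suc (length xs) ≤_)
        (trans (cong suc (length-++ as)) (sym (trans (length-++ as) (ℕ.+-suc _ _))))
        (s≤s (length-≤ xs! total′))
    where
    total′ : ∀ {x′} → x′ ∈ xs → ∃ λ y′ → y′ ∈ as ++ bs × R x′ y′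
    total′ x′∈ with total (there x′∈)
    ... | y′ , y′∈ , Rx′y′ with Any.++⁻ as y′∈
    ...   | inj₁ ∈as         = y′ , Any.++⁺ˡ ∈as , Rx′y′
    ...   | inj₂ (there ∈bs) = y′ , Any.++⁺ʳ as ∈bs , Rx′y′
    ...   | inj₂ (here refl) = ⊥-elim (All.lookup x∉xs x′∈ (injective Rxy Rx′y′))

module _ {P Q : Pred (List ℕ) 0ℓ} (P? : Decidable P) (Q? : Decidable Q) (n : ℕ) where

  count-≤ : (R : List ℕ → List ℕ → Set) → (∀ {x x′ y} → R x y → R x′ y → x ≡ x′) →
            (∀ {x} → IsPartition n x → P x → ∃ λ y → IsPartition n y × Q y × R x y) →
            count P? n ≤ count Q? n
  count-≤ R injective total = length-≤ R injective (Unique.filter⁺ P? (partitions-unique n)) total′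
    where
    total′ : ∀ {x} → x ∈ filter P? (partitions n) → ∃ λ y → y ∈ filter Q? (partitions n) × R x y
    total′ {x} x∈ with ∈-filter⁻ P? {xs = partitions n} x∈
    ... | x∈n , Px with total (to (∈-partitions n x) x∈n) Px
    ...   | y , πy , Qy , Rxy = y , ∈-filter⁺ Q? (from (∈-partitions n y) πy) Qy , Rxy

-- A bijection in relational form: injectivity gives one inequality, functionality the other through
-- the converse relation.
count-≡ : {P Q : Pred (List ℕ) 0ℓ} (P? : Decidable P) (Q? : Decidable Q) (n : ℕ)
  (R : List ℕ → List ℕ → Set) →
  (∀ {x x′ y} → R x y → R x′ y → x ≡ x′) → (∀ {x y y′} → R x y → R x y′ → y ≡ y′) →
  (∀ {x} → IsPartition n x → P x → ∃ λ y → IsPartition n y × Q y × R x y) →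
  (∀ {y} → IsPartition n y → Q y → ∃ λ x → IsPartition n x × P x × R x y) →
  count P? n ≡ count Q? n
count-≡ P? Q? n R injective functional forth back = ℕ.≤-antisym
  (count-≤ P? Q? n R injective forth)
  (count-≤ Q? P? n (λ y x → R x y) functional back)

count-cong : {P Q : Pred (List ℕ) 0ℓ} (P? : Decidable P) (Q? : Decidable Q) (n : ℕ) →
  (∀ {x} → IsPartition n x → P x ⇔ Q x) → count P? n ≡ count Q? n
count-cong P? Q? n P⇔Q = count-≡ P? Q? n _≡_ (λ p q → trans p (sym q)) (λ p q → trans (sym p) q)
  (λ π Px → _ , π , to (P⇔Q π) Px , refl) (λ π Qx → _ , π , from (P⇔Q π) Qx , refl)

module _ {A : Set} {P Q R : Pred A 0ℓ} (P? : Decidable P) (Q? : Decidable Q) (R? : Decidable R) where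

  length-filter-⊎ : ∀ xs → (∀ {x} → x ∈ xs → R x ⇔ (P x ⊎ Q x)) → (∀ {x} → x ∈ xs → P x → ¬ Q x) →
    length (filter P? xs) ℕ.+ length (filter Q? xs) ≡ length (filter R? xs)
  length-filter-⊎ [] _ _ = refl
  length-filter-⊎ (x ∷ xs) R⇔ disjoint
    with ih ← length-filter-⊎ xs (R⇔ ∘ there) (disjoint ∘ there)
    with P? x | Q? x | R? x
  ... | yes Px | yes Qx | _      = ⊥-elim (disjoint (here refl) Px Qx)
  ... | yes _  | no _   | yes _  = cong suc ih
  ... | yes Px | _      | no ¬Rx = ⊥-elim (¬Rx (from (R⇔ (here refl)) (inj₁ Px)))
  ... | no _   | yes _  | yes _  = trans (ℕ.+-suc _ _) (cong suc ih)
  ... | no _   | yes Qx | no ¬Rx = ⊥-elim (¬Rx (from (R⇔ (here refl)) (inj₂ Qx)))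
  ... | no ¬Px | no ¬Qx | yes Rx = ⊥-elim ([ ¬Px , ¬Qx ]′ (to (R⇔ (here refl)) Rx))
  ... | no _   | no _   | no _   = ih

count-complement : {P Q : Pred (List ℕ) 0ℓ} (P? : Decidable P) (Q? : Decidable Q) (n : ℕ) →
  (∀ {x} → IsPartition n x → P x ⊎ Q x) → (∀ {x} → IsPartition n x → P x → ¬ Q x) →
  count P? n ℕ.+ count Q? n ≡ length (partitions n)
count-complement P? Q? n cover disjoint = trans
  (length-filter-⊎ P? Q? (λ x → yes (refl {x = x})) (partitions n)
    (λ {x} x∈ → mk⇔ (λ _ → cover (to (∈-partitions n x) x∈)) (λ _ → refl))
    (λ {x} x∈ → disjoint (to (∈-partitions n x) x∈)))
  (cong length (filter-all (λ x → yes (refl {x = x})) (All.universal (λ _ → refl) (partitions n))))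

-- Fibres of `s` over distinct values are disjoint, so a cumulative sum becomes a single count.
sum-of-counts : {A : Set} (s : A → ℤ) (xs : List A) (rs : List ℤ) → Unique rs →
  sumℤ (map (λ r → + length (filter (λ x → s x ℤ.≟ r) xs)) rs) ≡ + length (filter (λ x → s x ∈? rs) xs)
sum-of-counts s xs [] _ = cong (+_ ∘ length) (sym (filter-none (λ x → s x ∈? []) (All.universal (λ _ ()) xs)))
sum-of-counts s xs (r ∷ rs) (r∉rs ∷ rs!) = trans
  (cong (ℤ._+_ (+ length (filter (λ x → s x ℤ.≟ r) xs))) (sum-of-counts s xs rs rs!))
  (cong +_ (length-filter-⊎ (λ x → s x ℤ.≟ r) (λ x → s x ∈? rs) (λ x → s x ∈? (r ∷ rs)) xs
    (λ _ → mk⇔ (λ { (here eq) → inj₁ eq ; (there ∈rs) → inj₂ ∈rs }) [ here , there ]′)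
    (λ { _ refl ∈rs → All.lookup r∉rs ∈rs refl })))

window-unique : ∀ b → Unique (window b)
window-unique b = Unique.map⁺ (λ eq → ℤ.+-injective (∙-cancelʳ (- + b) _ _ eq)) (Unique.upTo⁺ _)

∈-window : ∀ {b} z → ℤ.∣ z ∣ ≤ b → z ∈ window b
-- Index `i` of the window holds `i - b`, so `+ a` sits at `a + b`. In the negative case `b` is
-- `suc a + c` and the index is `c`.
∈-window {b} (+ a) a≤b = subst (_∈ window b) (cancel (+ a) (+ b))
  (∈-map⁺ _ (∈-upTo⁺ (s≤s (ℕ.+-monoˡ-≤ b a≤b))))
  where
  cancel : ∀ x y → x + y - y ≡ x
  cancel = solve-∀
∈-window {b} (ℤ.-[1+ a ]) a<b with c , refl ← ℕ.m≤n⇒∃[o]m+o≡n a<b =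
  subst (_∈ window b) (cancel (+ suc a) (+ c))
    (∈-map⁺ _ (∈-upTo⁺ (s≤s (ℕ.≤-trans (ℕ.m≤n+m c (suc a)) (ℕ.m≤m+n b b)))))
  where
  cancel : ∀ x y → y - (x + y) ≡ - x
  cancel = solve-∀

-- Were `s λs` outside the window, its count would vanish, yet `λs` itself is counted there.
supported⇒∈-window : (s : List ℕ → ℤ) (n : ℕ) →
  (∀ r → n ℕ.< ℤ.∣ r ∣ → + count (λ λs → s λs ℤ.≟ r) n ≡ + 0) →
  ∀ {λs} → IsPartition n λs → s λs ∈ window n
supported⇒∈-window s n vanishes {λs} π with ℤ.∣ s λs ∣ ≤? n
... | yes s≤n = ∈-window (s λs) s≤n
... | no  s≰n = ⊥-elim (ℕ.<-irrefl (sym (ℤ.+-injective (vanishes (s λs) (ℕ.≰⇒> s≰n))))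
  (∈-length (∈-filter⁺ (λ μs → s μs ℤ.≟ s λs) (from (∈-partitions n λs) π) refl)))

-- Integer conditions as conditions on natural numbers

minus≡pos : ∀ {i p k} → + i - + p ≡ + k → i ≡ k ℕ.+ p
minus≡pos {i} {p} {k} eq = ℤ.+-injective (trans (restore (+ i) (+ p)) (cong (_+ + p) eq))
  where
  restore : ∀ x y → x ≡ x - y + y
  restore = solve-∀

minus≡pos⁻ : ∀ {i p k} → i ≡ k ℕ.+ p → + i - + p ≡ + k
minus≡pos⁻ {p = p} {k} refl = cancel (+ k) (+ p)
  where
  cancel : ∀ x y → x + y - y ≡ x
  cancel = solve-∀

minus≡neg : ∀ {i p k} → + i - + p ≡ ℤ.-[1+ k ] → p ≡ i ℕ.+ suc k
minus≡neg {i} {p} {k} eq = ℤ.+-injective (trans (restore (+ i) (+ p)) (cong (λ z → + i - z) eq))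
  where
  restore : ∀ x y → y ≡ x - (x - y)
  restore = solve-∀

minus≡neg⁻ : ∀ {i p k} → p ≡ i ℕ.+ suc k → + i - + p ≡ ℤ.-[1+ k ]
minus≡neg⁻ {i} {k = k} refl = cancel (+ i) (+ suc k)
  where
  cancel : ∀ x y → x - (x + y) ≡ - y
  cancel = solve-∀

minus≤neg : ∀ a w k → + a - + w ℤ.≤ ℤ.-[1+ k ] ⇔ a ℕ.+ suc k ≤ w
minus≤neg a w k = mk⇔
  (λ le → ℤ.drop‿+≤+ (subst₂ ℤ._≤_ (lhs (+ a) (+ w) (+ suc k)) (rhs (+ w) (+ suc k))
                              (ℤ.+-monoˡ-≤ (+ w + + suc k) le)))
  (λ le → subst₂ ℤ._≤_ (lhs′ (+ a) (+ w) (+ suc k)) (rhs′ (+ w) (+ suc k))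
                 (ℤ.+-monoˡ-≤ (- (+ w + + suc k)) (ℤ.+≤+ le)))
  where
  lhs : ∀ x y z → x - y + (y + z) ≡ x + z
  lhs = solve-∀
  rhs : ∀ y z → - z + (y + z) ≡ y
  rhs = solve-∀
  lhs′ : ∀ x y z → x + z + - (y + z) ≡ x - y
  lhs′ = solve-∀
  rhs′ : ∀ y z → y + - (y + z) ≡ - z
  rhs′ = solve-∀

-- Without ones both sides fail: the crank is then the largest part, hence nonnegative. So the case
-- split in `crank` disappears for negative bounds.
crank≤neg : ∀ k λs → crank λs ℤ.≤ ℤ.-[1+ k ] ⇔ partsAbove (ones λs) λs ℕ.+ suc k ≤ ones λs
crank≤neg k λs with ones λs
... | zero  = mk⇔ (λ ()) (λ le → ⊥-elim (ℕ.m+1+n≰m 0 (ℕ.≤-trans (ℕ.m≤n+m (suc k) _) le)))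
... | suc w = minus≤neg (partsAbove (suc w) λs) (suc w) k

-- Trading a part d for d ones

++-decreasing : ∀ {d xs ys} → AllPairs _≥_ xs → AllPairs _≥_ ys → All (d ≤_) xs → All (_≤ d) ys →
                AllPairs _≥_ (xs ++ ys)
++-decreasing xs↘ ys↘ d≤xs ys≤d =
  AllPairs.++⁺ xs↘ ys↘ (All.map (λ d≤x → All.map (λ y≤d → ℕ.≤-trans y≤d d≤x) ys≤d) d≤xs)

++-decreasing⁻ : ∀ xs {ys} → AllPairs _≥_ (xs ++ ys) →
                 AllPairs _≥_ xs × AllPairs _≥_ ys × All (λ x → All (_≤ x) ys) xs
++-decreasing⁻ []       ys↘ = [] , ys↘ , []
++-decreasing⁻ (x ∷ xs) (≤x ∷ ↘) with xs↘ , ys↘ , ys≤ ← ++-decreasing⁻ xs ↘ =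
  All.++⁻ˡ xs ≤x ∷ xs↘ , ys↘ , All.++⁻ʳ xs ≤x ∷ ys≤

replicate-decreasing : ∀ d x → AllPairs _≥_ (replicate d x)
replicate-decreasing zero    x = []
replicate-decreasing (suc d) x = All.replicate⁺ d ℕ.≤-refl ∷ replicate-decreasing d x

sum-replicate-1 : ∀ d → sum (replicate d 1) ≡ d
sum-replicate-1 zero    = refl
sum-replicate-1 (suc d) = cong suc (sum-replicate-1 d)

ones-++ : ∀ xs ys → ones (xs ++ ys) ≡ ones xs ℕ.+ ones ys
ones-++ xs ys = trans (cong length (filter-++ (_≟ 1) xs ys)) (length-++ (filter (_≟ 1) xs))

ones-replicate-1 : ∀ d → ones (replicate d 1) ≡ d
ones-replicate-1 d = trans (cong length (filter-all (_≟ 1) (All.replicate⁺ d refl))) (length-replicate d)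

partsAbove-++ : ∀ w xs ys → partsAbove w (xs ++ ys) ≡ partsAbove w xs ℕ.+ partsAbove w ys
partsAbove-++ w xs ys = trans (cong length (filter-++ (w ℕ.<?_) xs ys)) (length-++ (filter (w ℕ.<?_) xs))

all-ones : ∀ {xs} → All (0 ℕ.<_) xs → All (_≤ 1) xs → xs ≡ replicate (length xs) 1
all-ones []       []         = refl
all-ones (0<x ∷ ps) (x≤1 ∷ qs) = cong₂ _∷_ (ℕ.≤-antisym x≤1 0<x) (all-ones ps qs)

trailing-ones : ∀ {xs} d → AllPairs _≥_ xs → All (0 ℕ.<_) xs → d ≤ ones xs → ∃ λ ys → xs ≡ ys ++ replicate d 1
trailing-ones {[]} zero _ _ _ = [] , refl
trailing-ones {x ∷ xs} d (≤x ∷ ↘) (p ∷ ps) d≤ with d ≤? ones xs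
... | yes d≤′ with ys , eq ← trailing-ones d ↘ ps d≤′ = x ∷ ys , cong (x ∷_) eq
... | no d≰ with x ≟ 1
...   | no x≢1 = ⊥-elim (d≰ (subst (d ≤_) (cong length (filter-reject (_≟ 1) x≢1)) d≤))
-- A head 1 makes every part a one, and `d`, above `ones xs` but at most `suc (ones xs)`, is the
-- full length.
...   | yes refl = [] , trans (cong (1 ∷_) xs≡) (cong (λ e → replicate e 1) (sym d≡))
  where
  xs≡ = all-ones ps ≤x
  ones≡ : ones xs ≡ length xs
  ones≡ = trans (cong ones xs≡) (ones-replicate-1 (length xs))
  d≡ : d ≡ suc (length xs)
  d≡ = trans (ℕ.≤-antisym d≤ (ℕ.≰⇒> d≰)) (cong suc ones≡)

-- The bounds on `above` and `below` make the decomposition recoverable from either list. Entry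
-- `length above` of the rank-set of `μs` is `length above` minus `d`, that is -k-1.
record Trade (k : ℕ) (λs μs : List ℕ) : Set where
  constructor mkTrade
  field
    above below : List ℕ
  d : ℕ
  d = length above ℕ.+ suc k
  field
    d≤above : All (d ≤_) above
    below≤d : All (_≤ d) below
    λs≡ : λs ≡ above ++ below ++ replicate d 1
    μs≡ : μs ≡ above ++ d ∷ below

-- The threshold grows with the prefix. Were one prefix to stop where the other goes on, the next
-- part would be at most the smaller threshold and at least the larger.
split-unique : ∀ k {d d′} xs xs′ {ys ys′} → d ≡ length xs ℕ.+ k → d′ ≡ length xs′ ℕ.+ k →
  All (d ≤_) xs → All (_≤ d) ys → All (d′ ≤_) xs′ → All (_≤ d′) ys′ →
  xs ++ ys ≡ xs′ ++ ys′ → xs ≡ xs′ × ys ≡ ys′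
split-unique k [] [] _ _ _ _ _ _ eq = refl , eq
split-unique k [] (x ∷ xs′) refl refl _ (x≤ ∷ _) (≤x ∷ _) _ refl =
  ⊥-elim (ℕ.<⇒≱ (s≤s (ℕ.m≤n+m k (length xs′))) (ℕ.≤-trans ≤x x≤))
split-unique k (x ∷ xs) [] refl refl (≤x ∷ _) _ _ (x≤ ∷ _) refl =
  ⊥-elim (ℕ.<⇒≱ (s≤s (ℕ.m≤n+m k (length xs))) (ℕ.≤-trans ≤x x≤))
split-unique k (x ∷ xs) (x′ ∷ xs′) d≡ d′≡ (_ ∷ d≤) ≤d (_ ∷ d′≤) ≤d′ eq
  with refl , eq′ ← ∷-injective eq
  -- Dropping a common head shortens the prefixes and raises `k` by one, leaving `d` and `d′`
  -- unchanged.
  with refl , ys≡ ← split-unique (suc k) xs xs′ (trans d≡ (sym (ℕ.+-suc _ k))) (trans d′≡ (sym (ℕ.+-suc _ k)))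
                      d≤ ≤d d′≤ ≤d′ eq′
  = refl , ys≡

-- Greedy choice: the prefix continues while the next part exceeds a threshold that rises by one
-- with each part taken.
split-exists : ∀ k xs → AllPairs _≥_ xs → ∃₂ λ ys zs →
  xs ≡ ys ++ zs × All (length ys ℕ.+ k ≤_) ys × All (_≤ length ys ℕ.+ k) zs
split-exists k [] _ = [] , [] , refl , [] , []
split-exists k (x ∷ xs) (≤x ∷ ↘) with x ≤? k
... | yes x≤k = [] , x ∷ xs , refl , [] , x≤k ∷ All.map (λ y≤x → ℕ.≤-trans y≤x x≤k) ≤x
... | no x≰k with split-exists (suc k) xs ↘
...   | ys , zs , refl , ≤ys , zs≤ rewrite ℕ.+-suc (length ys) k =
  x ∷ ys , zs , refl , head≤ ys ≤ys ≤x ∷ ≤ys , zs≤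
  where
  -- The test on `x` reaches the final threshold only if `x` ends the prefix; otherwise the next
  -- part meets that threshold and `x` is at least as large.
  head≤ : ∀ ys → All (suc (length ys ℕ.+ k) ≤_) ys → All (_≤ x) (ys ++ zs) → suc (length ys ℕ.+ k) ≤ x
  head≤ []       _        _        = ℕ.≰⇒> x≰k
  head≤ (y ∷ ys) (≤y ∷ _) (y≤x ∷ _) = ℕ.≤-trans ≤y y≤x

tail≤d : ∀ {d} ys → 1 ≤ d → All (_≤ d) ys → All (_≤ d) (ys ++ replicate d 1)
tail≤d {d} ys 1≤d ys≤ = All.++⁺ ys≤ (All.replicate⁺ d 1≤d)

sum-trade : ∀ A B d → sum (A ++ B ++ replicate d 1) ≡ sum (A ++ d ∷ B)
sum-trade A B d rewrite sum-++ A (B ++ replicate d 1) | sum-++ A (d ∷ B)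
  | sum-++ B (replicate d 1) | sum-replicate-1 d = cong (sum A ℕ.+_) (ℕ.+-comm (sum B) d)

-- A positive value rules out the default 0 that `part` returns past the end.
part-split : ∀ μs j {x} → part μs j ≡ suc x → ∃₂ λ A B → μs ≡ A ++ suc x ∷ B × length A ≡ j
part-split (x ∷ μs) zero    refl = [] , μs , refl , refl
part-split (y ∷ μs) (suc j) eq with A , B , refl , refl ← part-split μs j eq = y ∷ A , B , refl , refl

part-at : ∀ A {x B} → part (A ++ x ∷ B) (length A) ≡ x
part-at []      = refl
part-at (_ ∷ A) = part-at A

module _ (k : ℕ) where

  1≤d : ∀ a → 1 ≤ a ℕ.+ suc k
  1≤d a = ℕ.≤-trans (s≤s z≤n) (ℕ.m≤n+m (suc k) a)

  trade-injective : ∀ {λs λs′ μs} → Trade k λs μs → Trade k λs′ μs → λs ≡ λs′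
  trade-injective (mkTrade A B d≤A B≤d refl refl) (mkTrade A′ B′ d≤A′ B′≤d refl eq)
    with refl , refl ← split-unique (suc k) A A′ refl refl d≤A (ℕ.≤-refl ∷ B≤d) d≤A′ (ℕ.≤-refl ∷ B′≤d) eq
    = refl

  trade-functional : ∀ {λs μs μs′} → Trade k λs μs → Trade k λs μs′ → μs ≡ μs′
  trade-functional (mkTrade A B d≤A B≤d refl refl) (mkTrade A′ B′ d≤A′ B′≤d eq refl)
    -- The traded ones are at most `d`, since `d` is positive, so they belong to the lower segment;
    -- cancelling them recovers `below`.
    with refl , eq′ ← split-unique (suc k) A A′ refl refl d≤A (tail≤d B (1≤d (length A)) B≤d)
                        d≤A′ (tail≤d B′ (1≤d (length A′)) B′≤d) eq
    with refl ← ++-cancelʳ (replicate (length A ℕ.+ suc k) 1) B B′ eq′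
    = refl

  untrade : ∀ {n μs} → IsPartition n μs → ℤ.-[1+ k ] ∈rankSet μs →
            ∃ λ λs → IsPartition n λs × crank λs ℤ.≤ ℤ.-[1+ k ] × Trade k λs μs
  untrade {n} {μs} π (j , eq)
    with A , B , refl , refl ← part-split μs j (trans (minus≡neg eq) (ℕ.+-suc j k))
    rewrite sym (ℕ.+-suc (length A) k)
    with isPartition ↘ 0< total ← π
    with A↘ , (B≤d ∷ B↘) , ≤A ← ++-decreasing⁻ A ↘
    with (_ ∷ 0<B) ← All.++⁻ʳ A 0<
    = λs
    , isPartition (++-decreasing A↘ (++-decreasing B↘ (replicate-decreasing d 1) 0<B (All.replicate⁺ d ℕ.≤-refl)) d≤A rest≤d)
        (All.++⁺ (All.++⁻ˡ A 0<) (All.++⁺ 0<B (All.replicate⁺ d ℕ.≤-refl)))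
        (trans (sum-trade A B d) total)
    , from (crank≤neg k λs) (ℕ.≤-trans (ℕ.+-monoˡ-≤ (suc k) above≤) d≤ω)
    , mkTrade A B d≤A B≤d refl refl
    where
    d : ℕ
    d = length A ℕ.+ suc k
    rest λs : List ℕ
    rest = B ++ replicate d 1
    λs = A ++ rest
    d≤A : All (d ≤_) A
    d≤A = All.map All.head ≤A
    rest≤d : All (_≤ d) rest
    rest≤d = tail≤d B (1≤d (length A)) B≤d
    d≤ω : d ≤ ones λs
    d≤ω rewrite ones-++ A rest | ones-++ B (replicate d 1) | ones-replicate-1 d =
      ℕ.≤-trans (ℕ.m≤n+m d (ones B)) (ℕ.m≤n+m _ (ones A))
    -- Everything after `A` is at most `d`, hence at most the number of ones, so only parts of `A`
    -- can exceed it.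
    above≤ : partsAbove (ones λs) λs ≤ length A
    above≤ = begin
      partsAbove ω λs                           ≡⟨ partsAbove-++ ω A rest ⟩
      partsAbove ω A ℕ.+ partsAbove ω rest      ≡⟨ cong (λ xs → partsAbove ω A ℕ.+ length xs)
                                                     (filter-none (ω ℕ.<?_) (All.map (λ x≤d → ℕ.≤⇒≯ (ℕ.≤-trans x≤d d≤ω)) rest≤d)) ⟩
      partsAbove ω A ℕ.+ 0                      ≡⟨ ℕ.+-identityʳ _ ⟩
      partsAbove ω A                            ≤⟨ length-filter (ω ℕ.<?_) A ⟩
      length A                                  ∎
      where
      open ℕ.≤-Reasoning
      ω = ones λs

  -- If there were fewer than `d` ones, all of `A` would lie above their number, and the crank
  -- condition would itself yield `d` ones.
  enough-ones : ∀ A C → All (length A ℕ.+ suc k ≤_) A →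
    partsAbove (ones (A ++ C)) (A ++ C) ℕ.+ suc k ≤ ones (A ++ C) →
    length A ℕ.+ suc k ≤ ones (A ++ C)
  enough-ones A C d≤A cr with length A ℕ.+ suc k ≤? ones (A ++ C)
  ... | yes p = p
  ... | no d≰ω = ℕ.≤-trans (ℕ.+-monoˡ-≤ (suc k) A≤) cr
    where
    A≤ : length A ≤ partsAbove (ones (A ++ C)) (A ++ C)
    A≤ rewrite partsAbove-++ (ones (A ++ C)) A C
      | filter-all (ones (A ++ C) ℕ.<?_) (All.map (ℕ.≤-trans (ℕ.≰⇒> d≰ω)) d≤A) = ℕ.m≤m+n _ _

  -- If `A` is nonempty then `d` is at least 2, so `A` contains no ones and all of them lie in `C`.
  enough-onesʳ : ∀ A C → All (length A ℕ.+ suc k ≤_) A →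
    partsAbove (ones (A ++ C)) (A ++ C) ℕ.+ suc k ≤ ones (A ++ C) →
    length A ℕ.+ suc k ≤ ones C
  enough-onesʳ []        C d≤A cr = enough-ones [] C d≤A cr
  enough-onesʳ A@(_ ∷ A′) C d≤A cr = subst (length A ℕ.+ suc k ≤_)
    (trans (ones-++ A C) (cong (λ xs → length xs ℕ.+ ones C) (filter-none (_≟ 1) (All.map noOne d≤A))))
    (enough-ones A C d≤A cr)
    where
    noOne : ∀ {x} → length A ℕ.+ suc k ≤ x → ¬ x ≡ 1
    noOne (s≤s d≤) refl = ℕ.<⇒≱ (1≤d (length A′)) d≤

  trade : ∀ {n λs} → IsPartition n λs → crank λs ℤ.≤ ℤ.-[1+ k ] →
          ∃ λ μs → IsPartition n μs × ℤ.-[1+ k ] ∈rankSet μs × Trade k λs μs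
  trade {n} {λs} (isPartition ↘ 0< total) cr
    with A , C , refl , d≤A , C≤d ← split-exists (suc k) λs ↘
    with A↘ , C↘ , _ ← ++-decreasing⁻ A ↘
    with B , refl ← trailing-ones (length A ℕ.+ suc k) C↘ (All.++⁻ʳ A 0<) (enough-onesʳ A C d≤A (to (crank≤neg k (A ++ C)) cr))
    with B↘ , _ , _ ← ++-decreasing⁻ B C↘
    = A ++ length A ℕ.+ suc k ∷ B
    , isPartition (++-decreasing A↘ (All.++⁻ˡ B C≤d ∷ B↘) d≤A (ℕ.≤-refl ∷ All.++⁻ˡ B C≤d))
        (All.++⁺ (All.++⁻ˡ A 0<) (1≤d (length A) ∷ All.++⁻ˡ B (All.++⁻ʳ A 0<)))
        (trans (sym (sum-trade A B (length A ℕ.+ suc k))) total)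
    , (length A , minus≡neg⁻ (part-at A))
    , mkTrade A B d≤A (All.++⁻ˡ B C≤d) refl refl

-- Conjugation

-- `i < part λs j` says that the Young diagram has a cell in row `j`, column `i`; the field makes
-- the two diagrams transposes. Its symmetric form derives injectivity from functionality.
record Conjugate (λs μs : List ℕ) : Set where
  constructor mkConjugate
  field
    cell : ∀ i j → i ℕ.< part λs j ⇔ j ℕ.< part μs i

open Conjugate

conjugate-sym : ∀ {λs μs} → Conjugate λs μs → Conjugate μs λs
conjugate-sym c .cell i j = mk⇔ (from (cell c j i)) (to (cell c j i))

<-ext : ∀ {a b} → (∀ i → i ℕ.< a → i ℕ.< b) → a ≤ b
<-ext {zero}  _ = z≤n
<-ext {suc a} f = f a ℕ.≤-refl

-- Positivity makes the length visible: `part` cannot tell a trailing 0 from the end of the list.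
part-ext : ∀ {xs ys} → All (0 ℕ.<_) xs → All (0 ℕ.<_) ys → (∀ j → part xs j ≡ part ys j) → xs ≡ ys
part-ext [] [] _ = refl
part-ext [] (0<y ∷ _) eq = ⊥-elim (ℕ.<⇒≢ 0<y (eq 0))
part-ext (0<x ∷ _) [] eq = ⊥-elim (ℕ.<⇒≢ 0<x (sym (eq 0)))
part-ext (_ ∷ ps) (_ ∷ qs) eq = cong₂ _∷_ (eq 0) (part-ext ps qs (eq ∘ suc))

conjugate-functional : ∀ {λs μs μs′} → All (0 ℕ.<_) μs → All (0 ℕ.<_) μs′ →
                       Conjugate λs μs → Conjugate λs μs′ → μs ≡ μs′
conjugate-functional p p′ c c′ = part-ext p p′ λ i → ℕ.≤-antisym
  (<-ext λ j → to (cell c′ i j) ∘ from (cell c i j)) (<-ext λ j → to (cell c i j) ∘ from (cell c′ i j))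

part-mono : ∀ {xs} → AllPairs _≥_ xs → ∀ {i j} → i ≤ j → part xs j ≤ part xs i
part-mono [] _ = z≤n
part-mono (_ ∷ _) {zero} {zero} _ = ℕ.≤-refl
part-mono {x ∷ xs} (≤x ∷ _) {zero} {suc j} _ = bound xs ≤x j
  where
  bound : ∀ ys → All (_≤ x) ys → ∀ j → part ys j ≤ x
  bound []       _         _       = z≤n
  bound (_ ∷ _)  (y≤ ∷ _)  zero    = y≤
  bound (_ ∷ ys) (_ ∷ ys≤) (suc j) = bound ys ys≤ j
part-mono (_ ∷ ↘) {suc i} {suc j} (s≤s i≤j) = part-mono ↘ i≤j

part-past-end : ∀ xs → part xs (length xs) ≡ 0
part-past-end []       = refl
part-past-end (_ ∷ xs) = part-past-end xs

-- ys lists column lengths; the new row meets the first x columns.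
addRow : ℕ → List ℕ → List ℕ
addRow zero    ys       = ys
addRow (suc x) []       = 1 ∷ addRow x []
addRow (suc x) (y ∷ ys) = suc y ∷ addRow x ys

conjugate : List ℕ → List ℕ
conjugate []       = []
conjugate (x ∷ xs) = addRow x (conjugate xs)

sum-addRow : ∀ x ys → sum (addRow x ys) ≡ x ℕ.+ sum ys
sum-addRow zero    ys       = refl
sum-addRow (suc x) []       = cong suc (sum-addRow x [])
sum-addRow (suc x) (y ∷ ys) = cong suc (trans (cong (y ℕ.+_) (sum-addRow x ys)) (swap y x (sum ys)))
  where
  swap : ∀ a b c → a ℕ.+ (b ℕ.+ c) ≡ b ℕ.+ (a ℕ.+ c)
  swap = ℕ-Solver.solve-∀

addRow-≤ : ∀ {b} x {ys} → All (_≤ b) ys → All (_≤ suc b) (addRow x ys)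
addRow-≤ zero    ys≤        = All.map ℕ.m≤n⇒m≤1+n ys≤
addRow-≤ (suc x) []         = s≤s z≤n ∷ addRow-≤ x []
addRow-≤ (suc x) (y≤ ∷ ys≤) = s≤s y≤ ∷ addRow-≤ x ys≤

addRow-decreasing : ∀ x {ys} → AllPairs _≥_ ys → AllPairs _≥_ (addRow x ys)
addRow-decreasing zero    ↘        = ↘
addRow-decreasing (suc x) []       = addRow-≤ x [] ∷ addRow-decreasing x []
addRow-decreasing (suc x) (≤y ∷ ↘) = addRow-≤ x ≤y ∷ addRow-decreasing x ↘

addRow-positive : ∀ x {ys} → All (0 ℕ.<_) ys → All (0 ℕ.<_) (addRow x ys)
addRow-positive zero    ps       = ps
addRow-positive (suc x) []       = s≤s z≤n ∷ addRow-positive x []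
addRow-positive (suc x) (_ ∷ ps) = s≤s z≤n ∷ addRow-positive x ps

part-addRow-< : ∀ x ys {i} → i ℕ.< x → part (addRow x ys) i ≡ suc (part ys i)
part-addRow-< (suc x) []       {zero}  _         = refl
part-addRow-< (suc x) []       {suc i} (s≤s i<x) = part-addRow-< x [] i<x
part-addRow-< (suc x) (y ∷ ys) {zero}  _         = refl
part-addRow-< (suc x) (y ∷ ys) {suc i} (s≤s i<x) = part-addRow-< x ys i<x

part-addRow-≥ : ∀ x ys {i} → x ≤ i → part (addRow x ys) i ≡ part ys i
part-addRow-≥ zero    ys       _         = refl
part-addRow-≥ (suc x) []       (s≤s x≤i) = part-addRow-≥ x [] x≤i
part-addRow-≥ (suc x) (y ∷ ys) (s≤s x≤i) = part-addRow-≥ x ys x≤i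

conjugate-partition : ∀ {n} λs → IsPartition n λs → IsPartition n (conjugate λs)
conjugate-partition λs (isPartition _ _ refl) = go λs
  where
  go : ∀ λs → IsPartition (sum λs) (conjugate λs)
  go []       = isPartition [] [] refl
  go (x ∷ xs) with isPartition ↘ 0< total ← go xs =
    isPartition (addRow-decreasing x ↘) (addRow-positive x 0<)
      (trans (sum-addRow x (conjugate xs)) (cong (x ℕ.+_) total))

-- In a column `i < x` the new row supplies cell 0 and shifts the old cells down by one, as `x ∷ xs`
-- shifts the rows of `xs`.
conjugate-correct : ∀ {λs} → AllPairs _≥_ λs → Conjugate λs (conjugate λs)
conjugate-correct {[]} _ .cell i j = mk⇔ (λ ()) (λ ())
conjugate-correct {x ∷ xs} ↘@(_ ∷ xs↘) .cell i j with i ℕ.<? x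
conjugate-correct {x ∷ xs} ↘@(_ ∷ xs↘) .cell i zero    | yes i<x rewrite part-addRow-< x (conjugate xs) i<x =
  mk⇔ (λ _ → s≤s z≤n) (λ _ → i<x)
conjugate-correct {x ∷ xs} ↘@(_ ∷ xs↘) .cell i (suc j) | yes i<x rewrite part-addRow-< x (conjugate xs) i<x =
  mk⇔ (s≤s ∘ to (cell (conjugate-correct xs↘) i j)) (from (cell (conjugate-correct xs↘) i j) ∘ s≤s⁻¹)
-- Column `i` lies beyond the longest row `x`, so both sides are false.
conjugate-correct {x ∷ xs} ↘@(_ ∷ xs↘) .cell i j       | no i≮x rewrite part-addRow-≥ x (conjugate xs) (ℕ.≮⇒≥ i≮x) =
  mk⇔ (λ i< → ⊥-elim (i≮x (ℕ.≤-trans i< (part-mono ↘ (z≤n {j})))))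
      (λ j< → ⊥-elim (i≮x (ℕ.≤-trans (from (cell (conjugate-correct xs↘) i j) j<) (part-mono ↘ (z≤n {suc j})))))

-- Entry -k-1 at `j` says that column `j` of `λs` has exactly j+k+1 cells: row `r` is longer than
-- `j` iff r ≤ j+k. Entry `k` at `i` says that row `i` has length i-k, which exceeds `j` iff i >
-- j+k. At row `i` these clash.
rankSet-disjoint : ∀ k {λs μs} → AllPairs _≥_ λs → Conjugate λs μs →
                   (+ k) ∈rankSet λs → ℤ.-[1+ k ] ∈rankSet μs → ⊥
rankSet-disjoint k {λs} {μs} ↘ c (i , eq) (j , eq′) = [ left , right ]′ (ℕ.≤-<-connex i (j ℕ.+ k))
  where
  i≡ : i ≡ k ℕ.+ part λs i
  i≡ = minus≡pos eq
  μ≡ : part μs j ≡ suc (j ℕ.+ k)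
  μ≡ = trans (minus≡neg eq′) (ℕ.+-suc j k)
  left : i ≤ j ℕ.+ k → ⊥
  left i≤ = ℕ.<⇒≱ (ℕ.≤-trans j<λ (part-mono ↘ i≤))
    (ℕ.+-cancelˡ-≤ k _ _ (subst₂ _≤_ i≡ (ℕ.+-comm j k) i≤))
    where
    j<λ : j ℕ.< part λs (j ℕ.+ k)
    j<λ = from (cell c j (j ℕ.+ k)) (ℕ.≤-reflexive (sym μ≡))
  right : j ℕ.+ k ℕ.< i → ⊥
  right <i = ℕ.<-irrefl (sym μ≡) (to (cell c j (suc (j ℕ.+ k))) (ℕ.≤-trans j<λ (part-mono ↘ <i)))
    where
    j<λ : j ℕ.< part λs i
    j<λ = ℕ.+-cancelˡ-< k _ _ (subst₂ ℕ._<_ (ℕ.+-comm j k) i≡ <i)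

-- Search downwards from `b` for the first `j` with `j ≤ f j`. The test cannot fail at 0, and its
-- failure at `suc j` is the second bound.
crossing : (f : ℕ → ℕ) → ∀ b → f b ℕ.< b → ∃ λ j → j ≤ f j × f (suc j) ≤ j
crossing f (suc b) (s≤s fb≤) with b ≤? f b
... | yes b≤ = b , b≤ , fb≤
... | no b≰  = crossing f b (ℕ.≰⇒> b≰)

-- At a crossing of the row lengths shifted by `k`, the equality `j ≡ part λs (j + k)` would put `k`
-- in the rank-set. So row j+k is longer than `j`, the next row is not, and column `j` has exactly
-- j+k+1 cells.
rankSet-exhaustive : ∀ k {λs μs} → AllPairs _≥_ λs → Conjugate λs μs →
                     ¬ (+ k) ∈rankSet λs → ℤ.-[1+ k ] ∈rankSet μs
rankSet-exhaustive k {λs} {μs} ↘ c k∉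
  -- The search starts past the last part, where the shifted row length is 0.
  with crossing (λ j → part λs (j ℕ.+ k)) (suc (length λs))
         (s≤s (ℕ.≤-trans (part-mono ↘ (ℕ.m≤n⇒m≤1+n (ℕ.m≤m+n (length λs) k)))
                         (ℕ.≤-trans (ℕ.≤-reflexive (part-past-end λs)) z≤n)))
... | j , j≤ , ≤j = j , minus≡neg⁻ (trans (ℕ.≤-antisym upper lower) (sym (ℕ.+-suc j k)))
  where
  j≢ : ¬ j ≡ part λs (j ℕ.+ k)
  j≢ eq = k∉ (j ℕ.+ k , minus≡pos⁻ (trans (ℕ.+-comm j k) (cong (k ℕ.+_) eq)))
  lower : suc (j ℕ.+ k) ≤ part μs j
  lower = to (cell c j (j ℕ.+ k)) (ℕ.≤∧≢⇒< j≤ j≢)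
  upper : part μs j ≤ suc (j ℕ.+ k)
  upper = ℕ.≮⇒≥ λ lt → ℕ.<⇒≱ (from (cell c j (suc (j ℕ.+ k))) lt) ≤j

count-∉rankSet : ∀ k n → count (λ λs → ¬? ((+ k) ∈rankSet? λs)) n ≡ count (ℤ.-[1+ k ] ∈rankSet?_) n
count-∉rankSet k n = count-≡ _ _ n
  -- Positivity is part of the relation because a conjugate is unique only among lists of positive
  -- parts.
  (λ λs μs → All (0 ℕ.<_) λs × All (0 ℕ.<_) μs × Conjugate λs μs)
  (λ { (p , _ , c) (p′ , _ , c′) → conjugate-functional p p′ (conjugate-sym c) (conjugate-sym c′) })
  (λ { (_ , p , c) (_ , p′ , c′) → conjugate-functional p p′ c c′ })
  (λ {λs} π k∉ →
    let c  = conjugate-correct (decreasing π)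
        π′ = conjugate-partition λs π
    in conjugate λs , π′ , rankSet-exhaustive k (decreasing π) c k∉ , positive π , positive π′ , c)
  (λ {μs} π m∈ →
    let c  = conjugate-sym (conjugate-correct (decreasing π))
        π′ = conjugate-partition μs π
    in conjugate μs , π′ , (λ k∈ → rankSet-disjoint k (decreasing π′) c k∈ m∈) , positive π′ , positive π , c)

-- The cumulative functions

crank-∈-window : ∀ n {λs} → IsPartition (suc n) λs → crank λs ∈ window (suc n)
-- At 1 the support of `M` concerns `M₁`, not crank counts. The only partition has crank -1, the
-- first entry of the window.
crank-∈-window zero {λs} π with here refl ← from (∈-partitions 1 λs) π = here refl
crank-∈-window (suc n) π = supported⇒∈-window crank _ (proj₂ (M-support (suc (suc n)))) π

-- At n = 1 the exceptional values of M agree with the count for negative cranks.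
M≤-counts : ∀ k n → M≤ ℤ.-[1+ k ] (suc n) ≡ + count (λ λs → crank λs ℤ.≤? ℤ.-[1+ k ]) (suc n)
M≤-counts zero    zero = refl
M≤-counts (suc k) zero = refl
M≤-counts k (suc n) = trans
  (sum-of-counts crank (partitions N′) rs (Unique.filter⁺ (ℤ._≤? m) (window-unique N′)))
  (cong +_ (count-cong _ _ N′ λ π → mk⇔
    (λ ∈rs → proj₂ (∈-filter⁻ (ℤ._≤? m) {xs = window N′} ∈rs))
    (∈-filter⁺ (ℤ._≤? m) (crank-∈-window (suc n) π))))
  where
  m = ℤ.-[1+ k ]
  N′ = suc (suc n)
  rs = filter (ℤ._≤? m) (window N′)

M≤+q : ∀ k n → M≤ ℤ.-[1+ k ] (suc n) + + q (+ k) (suc n) ≡ + length (partitions (suc n))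
M≤+q k n = trans (cong (_+ + q (+ k) (suc n)) M≡) (cong +_
  (count-complement _ ((+ k) ∈rankSet?_) (suc n) (λ {x} _ → dichotomy x) (λ _ k∉ → k∉)))
  where
  dichotomy : ∀ x → ¬ (+ k) ∈rankSet x ⊎ (+ k) ∈rankSet x
  dichotomy x with (+ k) ∈rankSet? x
  ... | yes k∈ = inj₂ k∈
  ... | no k∉  = inj₁ k∉
  M≡ : M≤ ℤ.-[1+ k ] (suc n) ≡ + count (λ λs → ¬? ((+ k) ∈rankSet? λs)) (suc n)
  M≡ = trans (M≤-counts k n) (cong +_ (trans
    -- Trading replaces the crank condition by -k-1 in the rank-set; conjugation turns this into the
    -- complement of what `q` counts.
    (count-≡ _ _ (suc n) (Trade k) (trade-injective k) (trade-functional k) (trade k) (untrade k))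
    (sym (count-∉rankSet k (suc n)))))

-- Every rank lies in the window, which is cut between `m` and its successor.
N≤+p : ∀ m n → N≤ m n + p (ℤ.suc m) n ≡ + length (partitions n)
N≤+p m n = trans
  (cong₂ _+_ (sum-of-counts rank (partitions n) _ (Unique.filter⁺ (ℤ._≤? m) (window-unique n)))
             (sum-of-counts rank (partitions n) _ (Unique.filter⁺ (ℤ.suc m ℤ.≤?_) (window-unique n))))
  (cong +_ (count-complement _ _ n cover disjoint))
  where
  low = filter (ℤ._≤? m) (window n)
  high = filter (ℤ.suc m ℤ.≤?_) (window n)
  cover : ∀ {λs} → IsPartition n λs → rank λs ∈ low ⊎ rank λs ∈ high
  cover {λs} π with rank∈ ← supported⇒∈-window rank n (proj₂ (N-support n)) π | rank λs ℤ.≤? m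
  ... | yes ≤m = inj₁ (∈-filter⁺ (ℤ._≤? m) rank∈ ≤m)
  ... | no ≰m  = inj₂ (∈-filter⁺ (ℤ.suc m ℤ.≤?_) rank∈ (ℤ.i<j⇒suc[i]≤j (ℤ.≰⇒> ≰m)))
  disjoint : ∀ {λs} → IsPartition n λs → rank λs ∈ low → ¬ rank λs ∈ high
  disjoint _ ∈low ∈high = ℤ.<⇒≱
    (ℤ.suc[i]≤j⇒i<j (proj₂ (∈-filter⁻ (ℤ.suc m ℤ.≤?_) {xs = window n} ∈high)))
    (proj₂ (∈-filter⁻ (ℤ._≤? m) {xs = window n} ∈low))

theorem2p1 : (m : ℤ) (n : ℕ) → m < + 0 → n ≥ 1 → N≤ (m + + 1) n - M≤ m n ≡ + q (- m - + 1) n - p (m + + 2) n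
theorem2p1 (+ _) _ (ℤ.+<+ ()) _
theorem2p1 (ℤ.-[1+ k ]) (suc n) _ _ =
  -- `- m - + 1` computes to `+ k`, while `m + + 2` must be rewritten as the successor of `m + + 1`.
  rearrange {N≤ (m + + 1) (suc n)} {p (m + + 2) (suc n)} {M≤ m (suc n)} {+ q (+ k) (suc n)}
    (trans (cong (λ z → N≤ (m + + 1) (suc n) + p z (suc n)) (next m)) (N≤+p (m + + 1) (suc n))) (M≤+q k n)
  where
  m = ℤ.-[1+ k ]
  next : ∀ z → z + + 2 ≡ + 1 + (z + + 1)
  next = solve-∀
  rearrange : ∀ {a b c d e} → a + b ≡ e → c + d ≡ e → a - c ≡ d - b
  rearrange {a} {b} {c} {d} p q = trans (lhs a b c) (trans (cong (λ z → z - b - c) (trans p (sym q))) (rhs b c d))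
    where
    lhs : ∀ a b c → a - c ≡ a + b - b - c
    lhs = solve-∀
    rhs : ∀ b c d → c + d - b - c ≡ d - b
    rhs = solve-∀
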